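{- The coverability problem is undecidable for branch-effective branch-WSTS $\mathcal{S}=(X,\Sigma,\to,\leq,x_0)$, even when $\mathcal{S}$ is strongly monotone and $\leq$ is a well-quasi-ordering.
   Context: An OLTS is $(X,\Sigma,\to,\leq,x_0)$ with state set $X$, finite alphabet $\Sigma$, transitions ${\to}\subseteq X\times\Sigma\times X$, quasi-ordering $\leq$, initial state $x_0$; $\mathrm{Post}(x)=\{y\mid x\to y\}$, $\mathrm{Post}^*(x)$ the set of states reachable from $x$, and $\downarrow Y=\{z\mid z\leq y\text{ for some }y\in Y\}$. It is a branch-WSTS if finitely branching (each $\mathrm{Post}(x)$ finite), branch-monotone (whenever $x\xrightarrow{\sigma}x'$, $\sigma\in\Sigma^*$, and $x\leq x'$, there is $y$ with $x'\xrightarrow{\sigma}y$ and $x'\leq y$) and branch-wqo (the states visited along every run from $x_0$ form a set well-quasi-ordered by $\leq$); branch-effective if $\leq$ and each $\xrightarrow{a}$ are decidable and each $\mathrm{Post}(x)$ is computable. Strongly monotone: for all $x,y,x'$ with $x\leq y$ and $x\to x'$ there is $y'$ with $y\to y'$ and $x'\leq y'$. The coverability problem: given the system and a state $y$, is $y$ coverable from $x_0$, i.e. $y\in\downarrow\mathrm{Post}^*(x_0)$? -}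

module Defs where

open import Data.Nat using (ℕ; zero; suc; _<_; _≤_)
open import Data.Fin using (Fin)
open import Data.List using (List; []; _∷_; length)
open import Data.List.Membership.Propositional using (_∈_)
open import Data.Product using (Σ; ∃; ∃-syntax; _×_; _,_)
open import Relation.Nullary using (Dec)
open import Relation.Binary.PropositionalEquality using (_≡_)
open import Relation.Binary.Construct.Closure.ReflexiveTransitive using (Star)
open import Function.Bundles using (_⇔_)
open import Level using (_⊔_)

record OLTS : Set₁ where
  field
    X       : Set
    k       : ℕ
    _⟶[_]_  : X → Fin k → X → Set
    _≼_     : X → X → Set
    ≼-refl  : ∀ {x} → x ≼ x
    ≼-trans : ∀ {x y z} → x ≼ y → y ≼ z → x ≼ z
    x₀      : X

  _⟶_ : X → X → Set
  x ⟶ y = ∃[ a ] (x ⟶[ a ] y)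

  data _⟶⋆[_]_ : X → List (Fin k) → X → Set where
    ε    : ∀ {x} → x ⟶⋆[ [] ] x
    _◅_  : ∀ {x y z a w} → x ⟶[ a ] y → y ⟶⋆[ w ] z → x ⟶⋆[ a ∷ w ] z

  Reach : X → X → Set
  Reach = Star _⟶_

  Coverable : X → Set
  Coverable y = ∃[ z ] (Reach x₀ z × y ≼ z)


module _ (S : OLTS) where
  open OLTS S

  FinitelyBranching : Set
  FinitelyBranching = ∀ x → ∃[ ys ] (∀ y → (x ⟶ y) ⇔ (y ∈ ys))

  BranchMonotone : Set
  BranchMonotone = ∀ {x x'} (σ : List (Fin k)) → x ⟶⋆[ σ ] x' → x ≼ x' →
                   ∃[ y ] (x' ⟶⋆[ σ ] y × x' ≼ y)

  IsInfiniteRun : (ℕ → X) → Set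
  IsInfiniteRun r = r 0 ≡ x₀ × (∀ m → r m ⟶ r (suc m))

  IsFiniteRun : ℕ → (ℕ → X) → Set
  IsFiniteRun n r = r 0 ≡ x₀ × (∀ m → m < n → r m ⟶ r (suc m))

  -- branch-wqo: the set of states visited along every run from x₀ is wqo,
  -- i.e. every sequence of visited states has an increasing pair i < j.
  BranchWqo : Set
  BranchWqo =
    (∀ r → IsInfiniteRun r → ∀ (f : ℕ → ℕ) →
        ∃[ i ] ∃[ j ] (i < j × r (f i) ≼ r (f j)))
    × (∀ n r → IsFiniteRun n r → ∀ (f : ℕ → ℕ) → (∀ i → f i ≤ n) →
        ∃[ i ] ∃[ j ] (i < j × r (f i) ≼ r (f j)))

  record IsBranchWSTS : Set where
    field
      finitelyBranching : FinitelyBranching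
      branchMonotone    : BranchMonotone
      branchWqo         : BranchWqo

  record BranchEffective : Set where
    field
      ≼-dec   : ∀ x y → Dec (x ≼ y)
      ⟶-dec   : ∀ x a y → Dec (x ⟶[ a ] y)
      post    : X → List X
      post-ok : ∀ x y → (x ⟶ y) ⇔ (y ∈ post x)

  StronglyMonotone : Set
  StronglyMonotone = ∀ {x y x'} → x ≼ y → x ⟶ x' → ∃[ y' ] (y ⟶ y' × x' ≼ y')

  WellQuasiOrdered : Set
  WellQuasiOrdered = ∀ (f : ℕ → X) → ∃[ i ] ∃[ j ] (i < j × f i ≼ f j)

record CovInstance : Set₁ where
  field
    sys       : OLTS
    wsts      : IsBranchWSTS sys
    effective : BranchEffective sys
    strong    : StronglyMonotone sys
    wqo       : WellQuasiOrdered sys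
    target    : OLTS.X sys

COVER : CovInstance → Set
COVER I = OLTS.Coverable (CovInstance.sys I) (CovInstance.target I)

-- Two-counter (Minsky) machines: the standard undecidable halting problem.

data Ctr : Set where
  c₁ c₂ : Ctr

data Instr : Set where
  inc   : Ctr → ℕ → Instr
  jzdec : Ctr → ℕ → ℕ → Instr      -- if counter = 0 goto first label, else decrement and goto second

Program : Set
Program = List Instr

data _!_↦_ {A : Set} : List A → ℕ → A → Set where
  here  : ∀ {a as} → (a ∷ as) ! 0 ↦ a
  there : ∀ {a b as n} → as ! n ↦ b → (a ∷ as) ! suc n ↦ b

record Config : Set where
  constructor ⟨_,_,_⟩
  field
    pc : ℕ
    v₁ : ℕ
    v₂ : ℕ

data Step (P : Program) : Config → Config → Set where
  inc₁  : ∀ {p j m n} → P ! p ↦ inc c₁ j → Step P ⟨ p , m , n ⟩ ⟨ j , suc m , n ⟩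
  inc₂  : ∀ {p j m n} → P ! p ↦ inc c₂ j → Step P ⟨ p , m , n ⟩ ⟨ j , m , suc n ⟩
  zero₁ : ∀ {p j l n} → P ! p ↦ jzdec c₁ j l → Step P ⟨ p , 0 , n ⟩ ⟨ j , 0 , n ⟩
  zero₂ : ∀ {p j l m} → P ! p ↦ jzdec c₂ j l → Step P ⟨ p , m , 0 ⟩ ⟨ j , m , 0 ⟩
  dec₁  : ∀ {p j l m n} → P ! p ↦ jzdec c₁ j l → Step P ⟨ p , suc m , n ⟩ ⟨ l , m , n ⟩
  dec₂  : ∀ {p j l m n} → P ! p ↦ jzdec c₂ j l → Step P ⟨ p , m , suc n ⟩ ⟨ l , m , n ⟩

Halts : Program → Set
Halts P = ∃[ c ] (Star (Step P) ⟨ 0 , 0 , 0 ⟩ c × length P ≤ Config.pc c)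

-- Synthetic undecidability: many-one reduction from an undecidable problem
-- (every Agda function is computable, so the reduction is effective).

_⪯_ : ∀ {a b} {A : Set a} {B : Set b} → (A → Set) → (B → Set) → Set (a ⊔ b)
_⪯_ {A = A} {B} P Q = Σ (A → B) λ f → ∀ x → P x ⇔ Q (f x)

{-# OPTIONS --safe #-}
module Submission where

-- A program P is reduced to a system that counts upwards through 0, 1, 2, … and may
-- jump from n to an extra top state exactly when P halts within n steps; the top state
-- is then coverable iff P halts. Halting within n steps is decidable because two-counter
-- machines are deterministic, and it is monotone in n, which is all that strong
-- monotonicity needs. The order is ℕ with a top element adjoined, hence a wqo, so the
-- system is even a WSTS.

open import Defs
open import Data.Nat using (ℕ; zero; suc; _<_; _≤_; s≤s; _≤?_; _≟_)
open import Data.Nat.Properties using (≤-refl; ≤-trans; ≰⇒>; n<1+n)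
open import Data.Nat.Induction using (<-rec)
open import Data.Maybe using (Maybe; just; nothing)
import Data.Maybe as Maybe
open import Data.Maybe.Properties using (just-injective)
open import Data.Fin using (Fin)
open import Data.List using (List; []; _∷_; length)
open import Data.List.Relation.Unary.Any using (here; there)
open import Data.List.Membership.Propositional using (_∈_)
open import Data.Product using (∃-syntax; _×_; _,_; proj₂)
open import Function using (_∘_)
open import Relation.Nullary using (Dec; yes; no; ¬_; contradiction)
open import Relation.Unary using (Decidable)
open import Relation.Binary.PropositionalEquality using (_≡_; refl; sym; trans; subst)
open import Relation.Binary.Construct.Closure.ReflexiveTransitive using (Star; ε; _◅_; _◅◅_)
open import Function.Bundles using (_⇔_; mk⇔)
import Function.Properties.Equivalence as ⇔

module _ (S : OLTS) where
  open OLTS S hiding (ε)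

  LabelledStronglyMonotone : Set
  LabelledStronglyMonotone =
    ∀ {x y x' a} → x ≼ y → x ⟶[ a ] x' → ∃[ y' ] (y ⟶[ a ] y' × x' ≼ y')

  labelledStronglyMonotone⇒stronglyMonotone :
    LabelledStronglyMonotone → StronglyMonotone S
  labelledStronglyMonotone⇒stronglyMonotone mono x≼y (a , step) =
    let y' , step' , x'≼y' = mono x≼y step in y' , (a , step') , x'≼y'

  ⟶⋆-simulate : LabelledStronglyMonotone →
                ∀ {x y x' σ} → x ≼ y → x ⟶⋆[ σ ] x' → ∃[ y' ] (y ⟶⋆[ σ ] y' × x' ≼ y')
  ⟶⋆-simulate mono x≼y OLTS.ε = _ , OLTS.ε , x≼y
  ⟶⋆-simulate mono x≼y (step OLTS.◅ run) =
    let _ , step' , x₁≼y₁ = mono x≼y step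
        y' , run' , x'≼y' = ⟶⋆-simulate mono x₁≼y₁ run
    in y' , step' OLTS.◅ run' , x'≼y'

  labelledStronglyMonotone⇒branchMonotone : LabelledStronglyMonotone → BranchMonotone S
  labelledStronglyMonotone⇒branchMonotone mono σ run x≼x' = ⟶⋆-simulate mono x≼x' run

  wellQuasiOrdered⇒branchWqo : WellQuasiOrdered S → BranchWqo S
  wellQuasiOrdered⇒branchWqo wqo =
    (λ r _ f → wqo (r ∘ f)) , (λ _ r _ f _ → wqo (r ∘ f))

  branchEffective⇒finitelyBranching : BranchEffective S → FinitelyBranching S
  branchEffective⇒finitelyBranching eff x = post x , post-ok x
    where open BranchEffective eff

_‼_ : {A : Set} → List A → ℕ → Maybe A
[]       ‼ _     = nothing
(a ∷ as) ‼ zero  = just a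
(a ∷ as) ‼ suc n = as ‼ n

‼-sound : ∀ {A : Set} {as : List A} {n a} → as ‼ n ≡ just a → as ! n ↦ a
‼-sound {as = _ ∷ _} {zero}  refl = here
‼-sound {as = _ ∷ _} {suc n} eq   = there (‼-sound eq)

‼-complete : ∀ {A : Set} {as : List A} {n a} → as ! n ↦ a → as ‼ n ≡ just a
‼-complete here      = refl
‼-complete (there h) = ‼-complete h

exec : Instr → ℕ → ℕ → Config
exec (inc c₁ j)     m       n       = ⟨ j , suc m , n ⟩
exec (inc c₂ j)     m       n       = ⟨ j , m , suc n ⟩
exec (jzdec c₁ j l) zero    n       = ⟨ j , 0 , n ⟩
exec (jzdec c₁ j l) (suc m) n       = ⟨ l , m , n ⟩
exec (jzdec c₂ j l) m       zero    = ⟨ j , m , 0 ⟩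
exec (jzdec c₂ j l) m       (suc n) = ⟨ l , m , n ⟩

exec-step : ∀ {P p i m n} → P ! p ↦ i → Step P ⟨ p , m , n ⟩ (exec i m n)
exec-step {i = inc c₁ j}                 h = inc₁ h
exec-step {i = inc c₂ j}                 h = inc₂ h
exec-step {i = jzdec c₁ j l} {m = zero}  h = zero₁ h
exec-step {i = jzdec c₁ j l} {m = suc m} h = dec₁ h
exec-step {i = jzdec c₂ j l} {n = zero}  h = zero₂ h
exec-step {i = jzdec c₂ j l} {n = suc n} h = dec₂ h

module _ (P : Program) where

  step : Config → Maybe Config
  step ⟨ p , m , n ⟩ = Maybe.map (λ i → exec i m n) (P ‼ p)

  step-sound : ∀ {c c'} → step c ≡ just c' → Step P c c'
  step-sound {⟨ p , m , n ⟩} eq with P ‼ p in fetched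
  step-sound {⟨ p , m , n ⟩} refl | just i = exec-step (‼-sound fetched)

  step-complete : ∀ {c c'} → Step P c c' → step c ≡ just c'
  step-complete (inc₁ h)  rewrite ‼-complete h = refl
  step-complete (inc₂ h)  rewrite ‼-complete h = refl
  step-complete (zero₁ h) rewrite ‼-complete h = refl
  step-complete (zero₂ h) rewrite ‼-complete h = refl
  step-complete (dec₁ h)  rewrite ‼-complete h = refl
  step-complete (dec₂ h)  rewrite ‼-complete h = refl

  stuck-no-step : ∀ {c c'} → step c ≡ nothing → ¬ Step P c c'
  stuck-no-step stuck s with () ← trans (sym stuck) (step-complete s)

  step-unique : ∀ {c c' c''} → step c ≡ just c' → Step P c c'' → c'' ≡ c'
  step-unique next s = just-injective (trans (sym (step-complete s)) next)

  Halted : Config → Set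
  Halted c = length P ≤ Config.pc c

  data HaltsWithin : ℕ → Config → Set where
    halted  : ∀ {k c} → Halted c → HaltsWithin k c
    running : ∀ {k c c'} → Step P c c' → HaltsWithin k c' → HaltsWithin (suc k) c

  haltsWithin-mono : ∀ {k l c} → k ≤ l → HaltsWithin k c → HaltsWithin l c
  haltsWithin-mono _         (halted h)    = halted h
  haltsWithin-mono (s≤s k≤l) (running s h) = running s (haltsWithin-mono k≤l h)

  haltsWithin? : ∀ k → Decidable (HaltsWithin k)
  haltsWithin? k c with length P ≤? Config.pc c
  ... | yes h = yes (halted h)
  haltsWithin? zero c | no ¬h = no λ { (halted h) → ¬h h }
  haltsWithin? (suc k) c | no ¬h with step c in next
  ... | nothing = no λ { (halted h) → ¬h h ; (running s _) → stuck-no-step next s }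
  ... | just c' with haltsWithin? k c'
  ...   | yes h' = yes (running (step-sound next) h')
  ...   | no ¬h' = no λ { (halted h) → ¬h h
                        ; (running s h') → ¬h' (subst (HaltsWithin k) (step-unique next s) h') }

  haltsWithin⇒halts : ∀ {k c} → HaltsWithin k c → ∃[ c' ] (Star (Step P) c c' × Halted c')
  haltsWithin⇒halts (halted h)    = _ , ε , h
  haltsWithin⇒halts (running s h) =
    let c' , run , h' = haltsWithin⇒halts h in c' , s ◅ run , h'

  halts⇒haltsWithin : ∀ {c c'} → Star (Step P) c c' → Halted c' → ∃[ k ] HaltsWithin k c
  halts⇒haltsWithin ε         h = 0 , halted h
  halts⇒haltsWithin (s ◅ run) h =
    let k , hk = halts⇒haltsWithin run h in suc k , running s hk

  halts⇔haltsWithin : Halts P ⇔ (∃[ k ] HaltsWithin k ⟨ 0 , 0 , 0 ⟩)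
  halts⇔haltsWithin = mk⇔ (λ (_ , run , h) → halts⇒haltsWithin run h)
                          (haltsWithin⇒halts ∘ proj₂)

data ℕ⊤ : Set where
  fin : ℕ → ℕ⊤
  top : ℕ⊤

data _≤⊤_ : ℕ⊤ → ℕ⊤ → Set where
  fin≤fin : ∀ {m n} → m ≤ n → fin m ≤⊤ fin n
  fin≤top : ∀ {m} → fin m ≤⊤ top
  top≤top : top ≤⊤ top

≤⊤-refl : ∀ {x} → x ≤⊤ x
≤⊤-refl {fin m} = fin≤fin ≤-refl
≤⊤-refl {top}   = top≤top

≤⊤-trans : ∀ {x y z} → x ≤⊤ y → y ≤⊤ z → x ≤⊤ z
≤⊤-trans (fin≤fin p) (fin≤fin q) = fin≤fin (≤-trans p q)
≤⊤-trans (fin≤fin p) fin≤top     = fin≤top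
≤⊤-trans fin≤top     top≤top     = fin≤top
≤⊤-trans top≤top     top≤top     = top≤top

_≤⊤?_ : ∀ x y → Dec (x ≤⊤ y)
fin m ≤⊤? fin n with m ≤? n
... | yes p = yes (fin≤fin p)
... | no ¬p = no λ { (fin≤fin p) → ¬p p }
fin m ≤⊤? top   = yes fin≤top
top   ≤⊤? fin n = no λ ()
top   ≤⊤? top   = yes top≤top

Good : (ℕ → ℕ⊤) → Set
Good f = ∃[ i ] ∃[ j ] (i < j × f i ≤⊤ f j)

good-tail : ∀ {f} → Good (f ∘ suc) → Good f
good-tail (i , j , i<j , le) = suc i , suc j , s≤s i<j , le

good-adjacent : ∀ {f x y} → f 0 ≡ x → f 1 ≡ y → x ≤⊤ y → Good f
good-adjacent refl refl le = 0 , 1 , n<1+n 0 , le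

-- Strong induction on the first value: either it is below the second one, or the
-- tail starts at a strictly smaller natural number.
good-from-fin : ∀ m f → f 0 ≡ fin m → Good f
good-from-fin = <-rec (λ m → ∀ f → f 0 ≡ fin m → Good f) go
  where
  go : ∀ m → (∀ {m'} → m' < m → ∀ f → f 0 ≡ fin m' → Good f) → ∀ f → f 0 ≡ fin m → Good f
  go m rec f first with f 1 in second
  ... | top = good-adjacent first second fin≤top
  ... | fin m' with m ≤? m'
  ...   | yes m≤m' = good-adjacent first second (fin≤fin m≤m')
  ...   | no m≰m'  = good-tail {f} (rec (≰⇒> m≰m') (f ∘ suc) second)

≤⊤-wqo : ∀ f → Good f
≤⊤-wqo f with f 0 in first
... | fin m = good-from-fin m f first
... | top with f 1 in second
...   | fin m = good-tail {f} (good-from-fin m (f ∘ suc) second)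
...   | top   = good-adjacent first second top≤top

module Counting {Q : ℕ → Set} (Q? : Decidable Q) (Q-mono : ∀ {m n} → m ≤ n → Q m → Q n) where

  data _⟶[_]_ : ℕ⊤ → Fin 1 → ℕ⊤ → Set where
    count  : ∀ {m a} → fin m ⟶[ a ] fin (suc m)
    accept : ∀ {m a} → Q m → fin m ⟶[ a ] top
    stay   : ∀ {a} → top ⟶[ a ] top

  system : OLTS
  system = record
    { X = ℕ⊤ ; k = 1 ; _⟶[_]_ = _⟶[_]_ ; _≼_ = _≤⊤_
    ; ≼-refl = ≤⊤-refl ; ≼-trans = ≤⊤-trans ; x₀ = fin 0 }

  open OLTS system using (_⟶_; Reach; Coverable)

  labelledStronglyMonotone : LabelledStronglyMonotone system
  labelledStronglyMonotone (fin≤fin m≤n) count      = _ , count , fin≤fin (s≤s m≤n)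
  labelledStronglyMonotone (fin≤fin m≤n) (accept q) = _ , accept (Q-mono m≤n q) , top≤top
  labelledStronglyMonotone fin≤top       count      = _ , stay , fin≤top
  labelledStronglyMonotone fin≤top       (accept q) = _ , stay , top≤top
  labelledStronglyMonotone top≤top       stay       = _ , stay , top≤top

  _⟶?_ : ∀ x a y → Dec (x ⟶[ a ] y)
  (fin m ⟶? a) (fin n) with n ≟ suc m
  ... | yes refl = yes count
  ... | no n≢1+m = no λ { count → n≢1+m refl }
  (fin m ⟶? a) top with Q? m
  ... | yes q = yes (accept q)
  ... | no ¬q = no λ { (accept q) → ¬q q }
  (top ⟶? a) (fin n) = no λ ()
  (top ⟶? a) top     = yes stay

  post : ℕ⊤ → List ℕ⊤
  post (fin m) with Q? m
  ... | yes _ = fin (suc m) ∷ top ∷ []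
  ... | no _  = fin (suc m) ∷ []
  post top = top ∷ []

  post-complete : ∀ {x y} → x ⟶ y → y ∈ post x
  post-complete {fin m} (_ , count) with Q? m
  ... | yes _ = here refl
  ... | no _  = here refl
  post-complete {fin m} (_ , accept q) with Q? m
  ... | yes _ = there (here refl)
  ... | no ¬q = contradiction q ¬q
  post-complete (_ , stay) = here refl

  post-sound : ∀ {x y} → y ∈ post x → x ⟶ y
  post-sound {fin m} y∈post with Q? m | y∈post
  ... | yes q | here refl         = Fin.zero , count
  ... | yes q | there (here refl) = Fin.zero , accept q
  ... | no _  | here refl         = Fin.zero , count
  post-sound {top} (here refl) = Fin.zero , stay

  branchEffective : BranchEffective system
  branchEffective = record
    { ≼-dec = _≤⊤?_ ; ⟶-dec = _⟶?_ ; post = post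
    ; post-ok = λ _ _ → mk⇔ post-complete post-sound }

  coverInstance : CovInstance
  coverInstance = record
    { sys       = system
    ; wsts      = record
      { finitelyBranching = branchEffective⇒finitelyBranching system branchEffective
      ; branchMonotone    = labelledStronglyMonotone⇒branchMonotone system labelledStronglyMonotone
      ; branchWqo         = wellQuasiOrdered⇒branchWqo system ≤⊤-wqo }
    ; effective = branchEffective
    ; strong    = labelledStronglyMonotone⇒stronglyMonotone system labelledStronglyMonotone
    ; wqo       = ≤⊤-wqo
    ; target    = top }

  reach-fin : ∀ n → Reach (fin 0) (fin n)
  reach-fin zero    = ε
  reach-fin (suc n) = reach-fin n ◅◅ ((Fin.zero , count) ◅ ε)

  reach-top⇒witness : ∀ {m} → Reach (fin m) top → ∃[ n ] Q n
  reach-top⇒witness ((_ , count) ◅ run)    = reach-top⇒witness run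
  reach-top⇒witness ((_ , accept q) ◅ run) = _ , q

  coverable-top⇔witness : Coverable top ⇔ (∃[ n ] Q n)
  coverable-top⇔witness = mk⇔ to from
    where
    to : Coverable top → ∃[ n ] Q n
    to (top , run , top≤top) = reach-top⇒witness run
    from : ∃[ n ] Q n → Coverable top
    from (n , q) = top , reach-fin n ◅◅ ((Fin.zero , accept q) ◅ ε) , top≤top

theorem5p2 : Halts ⪯ COVER
theorem5p2 = C.coverInstance , λ P →
  ⇔.trans (halts⇔haltsWithin P) (⇔.sym (C.coverable-top⇔witness P))
  where
  module C P = Counting (λ k → haltsWithin? P k ⟨ 0 , 0 , 0 ⟩) (haltsWithin-mono P)
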